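{- The assertion "every $4$-total coloring of a cubic graph of order less than $20$ is equitable" is false, and the circular ladder $L_{12}$ is a counterexample of smallest possible order: $L_{12}$ admits a non-equitable $4$-total coloring, and for every cubic graph $G$ of order less than $12$, every $4$-total coloring of $G$ is equitable.
   Context: All graphs are finite, simple and cubic ($3$-regular), not necessarily connected. The order of a graph is its number of vertices. A $4$-total coloring of $G$ assigns one of the four colors $1,2,3,4$ to each vertex and each edge of $G$ so that adjacent vertices receive distinct colors, adjacent edges (edges sharing an endpoint) receive distinct colors, and every vertex and edge that are incident receive distinct colors. The color class $c_i$ is the set of all vertices and edges of color $i$. The coloring is equitable if $\bigl||c_i|-|c_j|\bigr| \le 1$ for all $i,j \in \{1,2,3,4\}$, and non-equitable otherwise. For even $n\ge 6$, the circular ladder $L_n$ is the prism $C_{n/2} \,\square\, K_2$ (Cartesian product of a cycle on $n/2$ vertices with $K_2$), which has $n$ vertices; thus $L_{12} = C_6 \,\square\, K_2$. -}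

module Defs where

open import Data.Empty using (⊥-elim)
open import Data.Fin using (Fin; toℕ; remQuot; _≟_; _<_; _<?_)
open import Data.List using (List; []; _∷_; _++_; map; mapMaybe; filter; length;
  allFin; cartesianProduct)
open import Data.List.Membership.Propositional using (_∈_)
open import Data.List.Membership.Propositional.Properties using (∈-allFin;
  ∈-cartesianProduct⁺; ∈-map⁺; ∈-map⁻; ∈-++⁺ˡ; ∈-++⁺ʳ)
import Data.List.Relation.Unary.All as All
open import Data.List.Relation.Unary.Any using (here; there)
open import Data.List.Relation.Unary.AllPairs using ([]; _∷_)
open import Data.List.Relation.Unary.Unique.Propositional using (Unique)
import Data.List.Relation.Unary.Unique.Propositional.Properties as Unique
open import Data.Maybe using (Maybe; just; nothing)
open import Data.Nat using (ℕ; suc; _*_; _≤_; s≤s; ∣_-_∣)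
import Data.Nat as ℕ
open import Data.Nat.Divisibility using (_∣_; divides)
open import Data.Nat.Properties using (*-cancelʳ-≤; 1+n≢n; m≤m+n)
open import Data.Product using (∃; _×_; _,_)
open import Data.Sum using (_⊎_; inj₁; inj₂; swap)
open import Data.Sum.Properties using (inj₁-injective; inj₂-injective)
open import Level using (0ℓ)
open import Relation.Binary.Core using (Rel)
open import Relation.Binary.Definitions using (Decidable; Symmetric; Irreflexive)
open import Relation.Binary.PropositionalEquality
open import Relation.Nullary using (¬_; yes; no)
open import Relation.Nullary.Decidable using (¬?; _×-dec_; _⊎-dec_; recompute)

record Graph (n : ℕ) : Set₁ where
  field
    _~_    : Rel (Fin n) 0ℓ
    _~?_   : Decidable _~_
    sym~   : Symmetric _~_
    irrefl : Irreflexive _≡_ _~_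

  neighbours : Fin n → List (Fin n)
  neighbours v = filter (v ~?_) (allFin n)

  degree : Fin n → ℕ
  degree v = length (neighbours v)

  order : ℕ
  order = n

  Cubic : Set
  Cubic = ∀ v → degree v ≡ 3

-- An unordered pair {lo , hi} of adjacent vertices is represented by its
-- increasing ordering.  The proof fields are irrelevant, so two edges are
-- propositionally equal exactly when they have the same endpoints.

record Edge {n : ℕ} (G : Graph n) : Set where
  constructor edge
  open Graph G
  field
    lo hi     : Fin n
    .lo<hi    : lo < hi
    .adjacent : lo ~ hi

Incident : ∀ {n} {G : Graph n} → Fin n → Edge G → Set
Incident v e = v ≡ Edge.lo e ⊎ v ≡ Edge.hi e

Element : ∀ {n} → Graph n → Set
Element {n} G = Fin n ⊎ Edge G

module _ {n : ℕ} (G : Graph n) where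
  open Graph G

  toEdge : Fin n × Fin n → Maybe (Edge G)
  toEdge (u , v) with (u <? v) ×-dec (u ~? v)
  ... | yes (u<v , u~v) = just (edge u v u<v u~v)
  ... | no  _           = nothing

  edges : List (Edge G)
  edges = mapMaybe toEdge (cartesianProduct (allFin n) (allFin n))

  elements : List (Element G)
  elements = map inj₁ (allFin n) ++ map inj₂ edges

Colour : Set
Colour = Fin 4

record TotalColouring {n : ℕ} (G : Graph n) : Set where
  open Graph G
  field
    colour          : Element G → Colour
    vertex-proper   : ∀ {u v} → u ~ v → colour (inj₁ u) ≢ colour (inj₁ v)
    edge-proper     : ∀ {v e f} → e ≢ f → Incident v e → Incident v f →
                      colour (inj₂ e) ≢ colour (inj₂ f)
    incident-proper : ∀ {v e} → Incident v e → colour (inj₁ v) ≢ colour (inj₂ e)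

  class : Colour → List (Element G)
  class i = filter (λ x → colour x ≟ i) (elements G)

  Equitable : Set
  Equitable = ∀ i j → ∣ length (class i) - length (class j) ∣ ≤ 1

  NonEquitable : Set
  NonEquitable = ¬ Equitable

Next : ∀ {k} → Rel (Fin k) 0ℓ
Next {k} i j = suc (toℕ i) ≡ toℕ j ⊎ (suc (toℕ i) ≡ k × toℕ j ≡ 0)

next? : ∀ {k} → Decidable (Next {k})
next? {k} i j =
  (suc (toℕ i) ℕ.≟ toℕ j) ⊎-dec ((suc (toℕ i) ℕ.≟ k) ×-dec (toℕ j ℕ.≟ 0))

next-irrefl : ∀ {k} → 3 ≤ k → (i : Fin k) → ¬ Next i i
next-irrefl 3≤k i (inj₁ eq)         = 1+n≢n eq
next-irrefl 3≤k i (inj₂ (eq , eq₀))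
  with s≤s () ← subst (3 ≤_) (trans (sym eq) (cong suc eq₀)) 3≤k

cycle : ∀ k → 3 ≤ k → Graph k
cycle k 3≤k = record
  { _~_    = λ i j → Next i j ⊎ Next j i
  ; _~?_   = λ i j → next? i j ⊎-dec next? j i
  ; sym~   = swap
  ; irrefl = λ { refl (inj₁ p) → next-irrefl 3≤k _ p
               ; refl (inj₂ p) → next-irrefl 3≤k _ p }
  }

complete : ∀ n → Graph n
complete n = record
  { _~_    = _≢_
  ; _~?_   = λ i j → ≢? i j
  ; sym~   = ≢-sym
  ; irrefl = λ eq neq → neq eq
  }
  where
  ≢? : Decidable (_≢_ {A = Fin n})
  ≢? i j = ¬? (i ≟ j)

-- The vertex (a , b) of the Cartesian product is encoded in Fin (m * n)
-- through the bijection remQuot.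
infixl 7 _□_
_□_ : ∀ {m n} → Graph m → Graph n → Graph (m * n)
_□_ {m} {n} G H = record
  { _~_    = λ x y → Adj (remQuot n x) (remQuot n y)
  ; _~?_   = λ x y → adj? (remQuot n x) (remQuot n y)
  ; sym~   = λ { (inj₁ (p , q)) → inj₁ (sym p , H.sym~ q)
               ; (inj₂ (p , q)) → inj₂ (G.sym~ p , sym q) }
  ; irrefl = λ { refl (inj₁ (_ , q)) → H.irrefl refl q
               ; refl (inj₂ (p , _)) → G.irrefl refl p }
  }
  where
  module G = Graph G
  module H = Graph H
  Adj : Rel (Fin m × Fin n) 0ℓ
  Adj (a , b) (a′ , b′) = (a ≡ a′ × b H.~ b′) ⊎ (a G.~ a′ × b ≡ b′)
  adj? : Decidable Adj
  adj? (a , b) (a′ , b′) =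
    ((a ≟ a′) ×-dec (b H.~? b′)) ⊎-dec ((a G.~? a′) ×-dec (b ≟ b′))

circularLadder : ∀ n → 2 ∣ n → 6 ≤ n → Graph n
circularLadder .(q * 2) (divides q refl) 6≤n =
  cycle q (*-cancelʳ-≤ 3 q 2 6≤n) □ complete 2

L₁₂ : Graph 12
L₁₂ = circularLadder 12 (divides 6 refl) (m≤m+n 6 6)

-- The list `elements G` contains every vertex and every edge exactly once,
-- so lengths of sublists of it are cardinalities.

module _ {n : ℕ} (G : Graph n) where
  open Graph G

  private
    pair : Edge G → Fin n × Fin n
    pair e = Edge.lo e , Edge.hi e

    toEdge-pair : ∀ e → toEdge G (pair e) ≡ just e
    toEdge-pair (edge u v u<v u~v) with (u <? v) ×-dec (u ~? v)
    ... | yes _ = refl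
    ... | no ¬p = ⊥-elim (¬p (recompute (u <? v) u<v , recompute (u ~? v) u~v))

    pair-toEdge : ∀ p {e} → toEdge G p ≡ just e → pair e ≡ p
    pair-toEdge (u , v) eq with (u <? v) ×-dec (u ~? v)
    pair-toEdge (u , v) refl | yes _ = refl

    ∈-mapMaybe⁺ : ∀ {e} ps → pair e ∈ ps → e ∈ mapMaybe (toEdge G) ps
    ∈-mapMaybe⁺ {e} (p ∷ ps) (here refl) with toEdge G p | toEdge-pair e
    ... | just _ | refl = here refl
    ∈-mapMaybe⁺ (p ∷ ps) (there e∈) with toEdge G p
    ... | just _  = there (∈-mapMaybe⁺ ps e∈)
    ... | nothing = ∈-mapMaybe⁺ ps e∈

    ∈-mapMaybe⁻ : ∀ {e} ps → e ∈ mapMaybe (toEdge G) ps → pair e ∈ ps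
    ∈-mapMaybe⁻ (p ∷ ps) e∈ with toEdge G p in eq
    ∈-mapMaybe⁻ (p ∷ ps) (here refl) | just _  = here (pair-toEdge p eq)
    ∈-mapMaybe⁻ (p ∷ ps) (there e∈)  | just _  = there (∈-mapMaybe⁻ ps e∈)
    ∈-mapMaybe⁻ (p ∷ ps) e∈          | nothing = there (∈-mapMaybe⁻ ps e∈)

    mapMaybe-unique : ∀ ps → Unique ps → Unique (mapMaybe (toEdge G) ps)
    mapMaybe-unique []       []         = []
    mapMaybe-unique (p ∷ ps) (p∉ ∷ ps!) with toEdge G p in eq
    ... | nothing = mapMaybe-unique ps ps!
    ... | just e  = All.tabulate (λ { f∈ refl →
                      All.lookup p∉ (∈-mapMaybe⁻ ps f∈) (sym (pair-toEdge p eq)) })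
                    ∷ mapMaybe-unique ps ps!

  ∈-edges : ∀ e → e ∈ edges G
  ∈-edges e = ∈-mapMaybe⁺ _ (∈-cartesianProduct⁺ (∈-allFin _) (∈-allFin _))

  edges-unique : Unique (edges G)
  edges-unique = mapMaybe-unique _
    (Unique.cartesianProduct⁺ (Unique.allFin⁺ n) (Unique.allFin⁺ n))

  ∈-elements : ∀ x → x ∈ elements G
  ∈-elements (inj₁ v) = ∈-++⁺ˡ (∈-map⁺ inj₁ (∈-allFin v))
  ∈-elements (inj₂ e) = ∈-++⁺ʳ (map inj₁ (allFin n)) (∈-map⁺ inj₂ (∈-edges e))

  elements-unique : Unique (elements G)
  elements-unique = Unique.++⁺
    (Unique.map⁺ inj₁-injective (Unique.allFin⁺ n))
    (Unique.map⁺ inj₂-injective edges-unique)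
    λ { (p , q) → disjoint (∈-map⁻ inj₁ p) (∈-map⁻ inj₂ q) }
    where
    disjoint : ∀ {x : Element G} {xs ys} → ∃ (λ v → v ∈ xs × x ≡ inj₁ v) →
               ¬ ∃ (λ e → e ∈ ys × x ≡ inj₂ e)
    disjoint (_ , _ , refl) (_ , _ , ())

{-# OPTIONS --safe #-}
-- In a cubic graph of order n every vertex meets all four colours (itself and
-- its three edges).  Hence, if colour i occurs on aᵢ vertices and eᵢ edges, then
-- n = aᵢ + 2eᵢ.  A vertex of colour i lies on an edge of
-- colour k ≠ i, and an edge has at most one endpoint of colour i, so aᵢ ≤ eₖ.
-- If |cᵢ| ≥ |cⱼ| + 2 then aᵢ ≥ aⱼ + 4; summing aₖ + 2aᵢ ≤ n over the two colours
-- k other than i and j gives 3aᵢ ≤ n + aⱼ, whence n ≥ 12.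
--
-- In L₁₂ equality is attained: rungs get colour 3, the vertex (a , b) gets
-- a + b mod 3, and any other edge gets the third colour in {0, 1, 2}.
module Submission where

open import Defs
open import Data.Fin using (Fin; toℕ; inject₁; remQuot; _≟_; _<?_; #_)
open import Data.Fin.Properties using (all?; any?; <-cmp; <-irrefl)
open import Data.List using (List; []; _∷_; _++_; map; filter; length; allFin)
open import Data.List.Properties using (length-map; length-++; length-++-sucʳ;
  length-tabulate; filter-++)
open import Data.List.Membership.Propositional using (_∈_; _∉_)
open import Data.List.Membership.Propositional.Properties using (∈-∃++;
  ∈-++⁺ˡ; ∈-++⁺ʳ; ∈-++⁻; ∈-allFin; ∈-filter⁺; ∈-filter⁻; ∈-map⁺; ∈-map⁻)
open import Data.List.Relation.Binary.Subset.Propositional using (_⊆_)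
open import Data.List.Relation.Unary.All as All using (All; []; _∷_)
import Data.List.Relation.Unary.All.Properties as All
open import Data.List.Relation.Unary.AllPairs as AllPairs using ([]; _∷_)
import Data.List.Relation.Unary.AllPairs.Properties as AllPairs
open import Data.List.Relation.Unary.Any as Any using (here; there)
open import Data.List.Relation.Unary.Unique.Propositional using (Unique)
import Data.List.Relation.Unary.Unique.Propositional.Properties as Unique
open import Data.Nat using (ℕ; zero; suc; _+_; _*_; _≤_; _<_; z≤n; s≤s; ∣_-_∣)
import Data.Nat as ℕ
open import Data.Nat.DivMod using (_mod_)
open import Data.Nat.Properties using (≤-trans; ≤-antisym;
  ≤-reflexive; +-identityʳ; +-mono-≤; +-monoʳ-≤; *-monoʳ-≤; +-cancelʳ-≤; m≤m+n; ≮⇒≥;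
  <⇒≱; ∣n-n∣≡0; module ≤-Reasoning)
open import Data.Nat.Solver using (module +-*-Solver)
open import Data.Product using (_×_; _,_; ∃-syntax; proj₁; proj₂)
open import Data.Sum using (_⊎_; inj₁; inj₂; [_,_]′)
open import Function using (_∘_)
open import Relation.Binary.Definitions using (tri<; tri≈; tri>)
open import Relation.Binary.PropositionalEquality
open import Relation.Nullary using (¬_; Dec; yes; no; contradiction)
open import Relation.Nullary.Decidable using (toWitness; ¬?; _×-dec_; _⊎-dec_; _→-dec_; recompute)
open import Relation.Unary using (Decidable)
open Graph using (Cubic; order)
open TotalColouring using (Equitable; NonEquitable)

-- Counting with duplicate-free lists.

length-⊆ : ∀ {A : Set} {xs ys : List A} → Unique xs → xs ⊆ ys → length xs ≤ length ys
length-⊆ [] _ = z≤n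
length-⊆ {xs = x ∷ xs} (x∉xs ∷ xs!) xs⊆ys
  -- Deleting one occurrence of `x` from `ys` leaves `as ++ bs`, which still contains the tail `xs`
  -- because `x` does not recur in it.
  with as , bs , refl ← ∈-∃++ (xs⊆ys (here refl)) =
  ≤-trans (s≤s (length-⊆ xs! xs⊆as++bs)) (≤-reflexive (sym (length-++-sucʳ as x bs)))
  where
  xs⊆as++bs : xs ⊆ as ++ bs
  xs⊆as++bs y∈xs with ∈-++⁻ as (xs⊆ys (there y∈xs))
  ... | inj₁ y∈as              = ∈-++⁺ˡ y∈as
  ... | inj₂ (here refl)       = contradiction refl (All.lookup x∉xs y∈xs)
  ... | inj₂ (there y∈bs)      = ∈-++⁺ʳ as y∈bs

length-allFin : ∀ n → length (allFin n) ≡ n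
length-allFin n = length-tabulate (λ i → i)

length-unique : ∀ {n} {xs : List (Fin n)} → Unique xs → length xs ≤ n
length-unique {n} xs! =
  ≤-trans (length-⊆ xs! (λ _ → ∈-allFin _)) (≤-reflexive (length-allFin n))

length-covering : ∀ {n} {xs : List (Fin n)} → (∀ i → i ∈ xs) → n ≤ length xs
length-covering {n} cover =
  ≤-trans (≤-reflexive (sym (length-allFin n))) (length-⊆ (Unique.allFin⁺ n) (λ _ → cover _))

-- Pigeonhole: prepending a missing `i` would give `suc n` distinct elements of `Fin n`.
unique⇒covering : ∀ {n} {xs : List (Fin n)} → Unique xs → length xs ≡ n → ∀ i → i ∈ xs
unique⇒covering {n} {xs} xs! eq i with Any.any? (i ≟_) xs
... | yes i∈xs = i∈xs
... | no  i∉xs = contradiction (length-unique (All.¬Any⇒All¬ xs i∉xs ∷ xs!)) (<⇒≱ (s≤s (≤-reflexive (sym eq))))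

length-filter-map : ∀ {A B : Set} {P : B → Set} (P? : Decidable P) (f : A → B) xs →
                    length (filter P? (map f xs)) ≡ length (filter (P? ∘ f) xs)
length-filter-map P? f []       = refl
length-filter-map P? f (x ∷ xs) with P? (f x)
... | yes _ = cong suc (length-filter-map P? f xs)
... | no  _ = length-filter-map P? f xs

-- The four colours and the arithmetic of their counts.

two-others : (i j : Colour) → i ≢ j →
             ∃[ k ] ∃[ l ] i ≢ k × i ≢ l × (∀ x → x ∈ i ∷ j ∷ k ∷ l ∷ [])
-- Finite search; four entries covering `Fin 4` are distinct, so `k` and `l` are exactly the colours
-- other than `i` and `j`.
two-others = toWitness {a? = all? λ i → all? λ j → ¬? (i ≟ j) →-dec any? λ k → any? λ l →
  ¬? (i ≟ k) ×-dec (¬? (i ≟ l) ×-dec all? λ x → Any.any? (x ≟_) (i ∷ j ∷ k ∷ l ∷ []))} _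

unbalanced⇒12≤n : ∀ {n} aᵢ aⱼ aₖ aₗ {eᵢ eⱼ eₖ eₗ} →
  aᵢ + 2 * eᵢ ≡ n → aⱼ + 2 * eⱼ ≡ n → aₖ + 2 * eₖ ≡ n → aₗ + 2 * eₗ ≡ n →
  aᵢ ≤ eₖ → aᵢ ≤ eₗ → n ≤ aᵢ + (aⱼ + (aₖ + aₗ)) →
  2 + (aⱼ + eⱼ) ≤ aᵢ + eᵢ → 12 ≤ n
unbalanced⇒12≤n {n} aᵢ aⱼ aₖ aₗ {eᵢ} {eⱼ} {eₖ} {eₗ} nᵢ nⱼ nₖ nₗ aᵢ≤eₖ aᵢ≤eₗ n≤ gap =
  ≤-trans (m≤m+n 12 (2 * aⱼ)) (+-cancelʳ-≤ aⱼ _ _ (begin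
    (12 + 2 * aⱼ) + aⱼ ≡⟨ solve 1 (λ x → (con 12 :+ con 2 :* x) :+ x := con 3 :* (con 4 :+ x)) refl aⱼ ⟩
    3 * (4 + aⱼ)       ≤⟨ *-monoʳ-≤ 3 4+aⱼ≤aᵢ ⟩
    3 * aᵢ             ≤⟨ 3aᵢ≤n+aⱼ ⟩
    n + aⱼ             ∎))
  where
  open ≤-Reasoning
  open +-*-Solver
  4+aⱼ≤aᵢ : 4 + aⱼ ≤ aᵢ
  -- Doubling the gap eliminates the edge counts, since `2 * (a + e)` is `a + n` for either colour.
  4+aⱼ≤aᵢ = +-cancelʳ-≤ n _ _ (begin
    (4 + aⱼ) + n              ≡⟨ cong ((4 + aⱼ) +_) nⱼ ⟨
    (4 + aⱼ) + (aⱼ + 2 * eⱼ)  ≡⟨ solve 2 (λ a e → (con 4 :+ a) :+ (a :+ con 2 :* e) := con 2 :* (con 2 :+ (a :+ e))) refl aⱼ eⱼ ⟩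
    2 * (2 + (aⱼ + eⱼ))       ≤⟨ *-monoʳ-≤ 2 gap ⟩
    2 * (aᵢ + eᵢ)             ≡⟨ solve 2 (λ a e → con 2 :* (a :+ e) := a :+ (a :+ con 2 :* e)) refl aᵢ eᵢ ⟩
    aᵢ + (aᵢ + 2 * eᵢ)        ≡⟨ cong (aᵢ +_) nᵢ ⟩
    aᵢ + n                    ∎)
  3aᵢ≤n+aⱼ : 3 * aᵢ ≤ n + aⱼ
  -- Adding `aᵢ + n` to both sides avoids subtraction: the `n` on the left is bounded by the sum of
  -- the four vertex counts, and the terms regroup into `aₖ + 2 * aᵢ` and `aₗ + 2 * aᵢ`, each at
  -- most `n`.
  3aᵢ≤n+aⱼ = +-cancelʳ-≤ (aᵢ + n) _ _ (begin
    3 * aᵢ + (aᵢ + n)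
      ≤⟨ +-monoʳ-≤ (3 * aᵢ) (+-monoʳ-≤ aᵢ n≤) ⟩
    3 * aᵢ + (aᵢ + (aᵢ + (aⱼ + (aₖ + aₗ))))
      ≡⟨ solve 4 (λ i j k l → con 3 :* i :+ (i :+ (i :+ (j :+ (k :+ l)))) :=
           (i :+ j) :+ ((k :+ con 2 :* i) :+ (l :+ con 2 :* i))) refl aᵢ aⱼ aₖ aₗ ⟩
    (aᵢ + aⱼ) + ((aₖ + 2 * aᵢ) + (aₗ + 2 * aᵢ))
      ≤⟨ +-monoʳ-≤ (aᵢ + aⱼ) (+-mono-≤ (+-monoʳ-≤ aₖ (*-monoʳ-≤ 2 aᵢ≤eₖ)) (+-monoʳ-≤ aₗ (*-monoʳ-≤ 2 aᵢ≤eₗ))) ⟩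
    (aᵢ + aⱼ) + ((aₖ + 2 * eₖ) + (aₗ + 2 * eₗ))
      ≡⟨ cong ((aᵢ + aⱼ) +_) (cong₂ _+_ nₖ nₗ) ⟩
    (aᵢ + aⱼ) + (n + n)
      ≡⟨ solve 3 (λ i j n → (i :+ j) :+ (n :+ n) := (n :+ j) :+ (i :+ n)) refl aᵢ aⱼ n ⟩
    (n + aⱼ) + (aᵢ + n)  ∎)

∣m-n∣≤1 : ∀ {m n} → m ≤ suc n → n ≤ suc m → ∣ m - n ∣ ≤ 1
∣m-n∣≤1 {zero}  {n}     _       q       = q
∣m-n∣≤1 {suc m} {zero}  p       _       = p
∣m-n∣≤1 {suc m} {suc n} (s≤s p) (s≤s q) = ∣m-n∣≤1 p q

-- Edges as unordered pairs of adjacent vertices.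

module _ {n : ℕ} {G : Graph n} where
  open Graph G using (_~_; _~?_; sym~; irrefl; neighbours)
  open Edge using (lo; hi)

  lo≢hi : (e : Edge G) → lo e ≢ hi e
  lo≢hi (edge u v u<v _) eq = <-irrefl eq (recompute (u <? v) u<v)

  lo~hi : (e : Edge G) → lo e ~ hi e
  lo~hi (edge u v _ u~v) = recompute (u ~? v) u~v

  -- Edges are stored increasingly, so trichotomy chooses the orientation. The last component
  -- records that there are no further endpoints.
  edgeTo : ∀ {v w} → v ~ w →
           ∃[ e ] Incident {G = G} v e × Incident w e × (∀ {u} → Incident u e → u ≡ v ⊎ u ≡ w)
  edgeTo {v} {w} v~w with <-cmp v w
  ... | tri< v<w _ _ = edge v w v<w v~w , inj₁ refl , inj₂ refl , λ i → i
  ... | tri≈ _ eq _  = contradiction v~w (irrefl eq)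
  ... | tri> _ _ w<v = edge w v w<v (sym~ v~w) , inj₂ refl , inj₁ refl ,
                       λ { (inj₁ eq) → inj₂ eq ; (inj₂ eq) → inj₁ eq }

  -- If the edges agree, `w` is an endpoint of the edge from `v` to `w′`, and it is not `v` by
  -- irreflexivity.
  edgeTo-injective : ∀ {v w w′} (p : v ~ w) (q : v ~ w′) →
                     proj₁ (edgeTo p) ≡ proj₁ (edgeTo q) → w ≡ w′
  edgeTo-injective {w = w} p q eq with edgeTo p | edgeTo q
  ... | e , _ , w∈e , _ | e′ , _ , _ , ends with ends (subst (Incident w) eq w∈e)
  ...   | inj₁ w≡v  = contradiction p (irrefl (sym w≡v))
  ...   | inj₂ w≡w′ = w≡w′

  -- Colours around a vertex of a cubic graph.

  module _ (cubic : Cubic G) (c : TotalColouring G) where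
    open TotalColouring c hiding (Equitable; NonEquitable)

    vertexColour : Fin n → Colour
    vertexColour v = colour (inj₁ v)

    edgeColour : Edge G → Colour
    edgeColour e = colour (inj₂ e)

    -- Stated for any list of vertices adjacent to `v`, so that distinctness goes by induction; it
    -- is applied to `neighbours v`.
    edgeColours : ∀ {v ws} → All (v ~_) ws → List Colour
    edgeColours = All.reduce (λ p → edgeColour (proj₁ (edgeTo p)))

    length-edgeColours : ∀ {v ws} (ps : All (v ~_) ws) → length (edgeColours ps) ≡ length ws
    length-edgeColours []       = refl
    length-edgeColours (p ∷ ps) = cong suc (length-edgeColours ps)

    edgeColour-∉ : ∀ {v w ws} (p : v ~ w) (ps : All (v ~_) ws) → All (w ≢_) ws →
                   All (edgeColour (proj₁ (edgeTo p)) ≢_) (edgeColours ps)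
    edgeColour-∉ p []       []         = []
    edgeColour-∉ p (q ∷ ps) (w≢ ∷ w∉) =
      edge-proper (w≢ ∘ edgeTo-injective p q)
        (proj₁ (proj₂ (edgeTo p))) (proj₁ (proj₂ (edgeTo q))) ∷ edgeColour-∉ p ps w∉

    edgeColours-unique : ∀ {v ws} (ps : All (v ~_) ws) → Unique ws → Unique (edgeColours ps)
    edgeColours-unique []       []         = []
    edgeColours-unique (p ∷ ps) (w∉ ∷ ws!) = edgeColour-∉ p ps w∉ ∷ edgeColours-unique ps ws!

    vertexColour-∉ : ∀ {v ws} (ps : All (v ~_) ws) → All (vertexColour v ≢_) (edgeColours ps)
    vertexColour-∉ []       = []
    vertexColour-∉ (p ∷ ps) = incident-proper (proj₁ (proj₂ (edgeTo p))) ∷ vertexColour-∉ ps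

    ∈-edgeColours⁻ : ∀ {v ws k} (ps : All (v ~_) ws) → k ∈ edgeColours ps →
                     ∃[ e ] Incident v e × edgeColour e ≡ k
    ∈-edgeColours⁻ (p ∷ ps) (here eq)  = proj₁ (edgeTo p) , proj₁ (proj₂ (edgeTo p)) , sym eq
    ∈-edgeColours⁻ (p ∷ ps) (there k∈) = ∈-edgeColours⁻ ps k∈

    -- The colours of `v` and of its three edges are pairwise distinct by properness, and there are
    -- only four colours.
    every-colour-at : ∀ v k → vertexColour v ≡ k ⊎ ∃[ e ] Incident v e × edgeColour e ≡ k
    every-colour-at v k
      with unique⇒covering {xs = vertexColour v ∷ edgeColours ps}
             (vertexColour-∉ ps ∷ edgeColours-unique ps (Unique.filter⁺ (v ~?_) (Unique.allFin⁺ n)))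
             (cong suc (trans (length-edgeColours ps) (cubic v))) k
      where
      ps : All (v ~_) (neighbours v)
      ps = All.all-filter (v ~?_) (allFin n)
    ... | here eq  = inj₁ (sym eq)
    ... | there k∈ = inj₂ (∈-edgeColours⁻ _ k∈)

    -- Vertex and edge counts of a colour class.

    vertices : Colour → List (Fin n)
    vertices i = filter (λ v → vertexColour v ≟ i) (allFin n)

    edgesOf : Colour → List (Edge G)
    edgesOf i = filter (λ e → edgeColour e ≟ i) (edges G)

    vertices-unique : ∀ i → Unique (vertices i)
    vertices-unique i = Unique.filter⁺ _ (Unique.allFin⁺ n)

    ∈-vertices⁺ : ∀ {v i} → vertexColour v ≡ i → v ∈ vertices i
    ∈-vertices⁺ = ∈-filter⁺ _ (∈-allFin _)

    ∈-vertices⁻ : ∀ {v i} → v ∈ vertices i → vertexColour v ≡ i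
    ∈-vertices⁻ {i = i} = proj₂ ∘ ∈-filter⁻ (λ v → vertexColour v ≟ i) {xs = allFin n}

    ∈-edgesOf⁺ : ∀ {e i} → edgeColour e ≡ i → e ∈ edgesOf i
    ∈-edgesOf⁺ = ∈-filter⁺ _ (∈-edges G _)

    ∈-edgesOf⁻ : ∀ {e i} → e ∈ edgesOf i → edgeColour e ≡ i
    ∈-edgesOf⁻ {i = i} = proj₂ ∘ ∈-filter⁻ (λ e → edgeColour e ≟ i) {xs = edges G}

    length-class : ∀ i → length (class i) ≡ length (vertices i) + length (edgesOf i)
    length-class i = trans (cong length (filter-++ P? (map inj₁ (allFin n)) _))
      (trans (length-++ (filter P? (map inj₁ (allFin n))))
        (cong₂ _+_ (length-filter-map P? inj₁ (allFin n)) (length-filter-map P? inj₂ (edges G))))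
      where
      P? = λ x → colour x ≟ i

    -- The edges of colour `i` form a perfect matching of the vertices not coloured `i`, so this
    -- list will contain each vertex exactly once.
    covered : Colour → List (Fin n)
    covered i = vertices i ++ (map lo (edgesOf i) ++ map hi (edgesOf i))

    -- Two different edges with the same `end` are adjacent, hence cannot both have colour `i`.
    ends-unique : ∀ {i} (end : Edge G → Fin n) → (∀ e → Incident (end e) e) → Unique (map end (edgesOf i))
    ends-unique {i} end inc = AllPairs.map⁺
      (unique-on (edgesOf i) (All.all-filter _ (edges G)) (Unique.filter⁺ _ (edges-unique G)))
      where
      unique-on : ∀ es → All (λ e → edgeColour e ≡ i) es → Unique es →
                  AllPairs.AllPairs (λ e f → end e ≢ end f) es
      unique-on []       []         []         = []
      unique-on (e ∷ es) (ei ∷ eis) (e∉ ∷ es!) =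
        All.zipWith (λ {f} (e≢f , fi) eq →
          edge-proper e≢f (inc e) (subst (λ v → Incident v f) (sym eq) (inc f)) (trans ei (sym fi)))
          (e∉ , eis) ∷ unique-on es eis es!

    covered-unique : ∀ i → Unique (covered i)
    covered-unique i = Unique.++⁺ (vertices-unique i)
      (Unique.++⁺ (ends-unique lo (λ _ → inj₁ refl)) (ends-unique hi (λ _ → inj₂ refl)) los#his)
      λ { (v∈ , u∈) → [ end∉ lo (λ _ → inj₁ refl) v∈ , end∉ hi (λ _ → inj₂ refl) v∈ ]′ (∈-++⁻ _ u∈) }
      where
      los#his : ∀ {v} → ¬ (v ∈ map lo (edgesOf i) × v ∈ map hi (edgesOf i))
      los#his (v∈lo , v∈hi) with ∈-map⁻ lo v∈lo | ∈-map⁻ hi v∈hi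
      ... | e , e∈ , refl | f , f∈ , eq =
        -- A single edge with `lo` equal to `hi` would be a loop, so `e` and `f` are distinct edges
        -- of colour `i` sharing a vertex.
        edge-proper (λ { refl → lo≢hi e eq }) (inj₁ refl) (inj₂ eq)
          (trans (∈-edgesOf⁻ e∈) (sym (∈-edgesOf⁻ f∈)))
      end∉ : (end : Edge G → Fin n) → (∀ e → Incident (end e) e) →
             ∀ {v} → v ∈ vertices i → v ∉ map end (edgesOf i)
      end∉ end inc v∈ u∈ with ∈-map⁻ end u∈
      ... | e , e∈ , refl = incident-proper (inc e) (trans (∈-vertices⁻ v∈) (sym (∈-edgesOf⁻ e∈)))

    covered-all : ∀ i v → v ∈ covered i
    covered-all i v with every-colour-at v i
    ... | inj₁ eq = ∈-++⁺ˡ (∈-vertices⁺ eq)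
    ... | inj₂ (e , inj₁ refl , eq) = ∈-++⁺ʳ (vertices i) (∈-++⁺ˡ (∈-map⁺ lo (∈-edgesOf⁺ eq)))
    ... | inj₂ (e , inj₂ refl , eq) =
      ∈-++⁺ʳ (vertices i) (∈-++⁺ʳ (map lo (edgesOf i)) (∈-map⁺ hi (∈-edgesOf⁺ eq)))

    length-covered : ∀ i → length (covered i) ≡ length (vertices i) + 2 * length (edgesOf i)
    length-covered i = trans (length-++ (vertices i)) (cong (length (vertices i) +_)
      (trans (length-++ (map lo (edgesOf i))) (cong₂ _+_ (length-map lo (edgesOf i))
        (trans (length-map hi (edgesOf i)) (sym (+-identityʳ _))))))

    -- Absence of repetitions in `covered i` bounds its length above by `n`; `every-colour-at`,
    -- through `covered-all`, bounds it below.
    perfect : ∀ i → length (vertices i) + 2 * length (edgesOf i) ≡ n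
    perfect i = trans (sym (length-covered i))
      (≤-antisym (length-unique (covered-unique i)) (length-covering (covered-all i)))

    -- Each vertex of colour `i` meets an edge of colour `k` and is recovered from it as its `end`.
    -- Edges with no endpoint of colour `i` get the default `hi e`, which only enlarges the image.
    vertices≤edges : ∀ {i k} → i ≢ k → length (vertices i) ≤ length (edgesOf k)
    vertices≤edges {i} {k} i≢k =
      ≤-trans (length-⊆ (vertices-unique i) vertices⊆ends) (≤-reflexive (length-map end (edgesOf k)))
      where
      -- the only endpoint that can have colour i
      end : Edge G → Fin n
      end e with vertexColour (lo e) ≟ i
      ... | yes _ = lo e
      ... | no  _ = hi e

      incident⇒end : ∀ {v} e → vertexColour v ≡ i → Incident v e → v ≡ end e
      incident⇒end e vi v∈e with vertexColour (lo e) ≟ i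
      incident⇒end e vi (inj₁ eq)   | yes _   = eq
      -- Both endpoints would have colour `i`, although they are adjacent.
      incident⇒end e vi (inj₂ refl) | yes loi = contradiction (trans loi (sym vi)) (vertex-proper (lo~hi e))
      incident⇒end e vi (inj₁ refl) | no ¬loi = contradiction vi ¬loi
      incident⇒end e vi (inj₂ eq)   | no _    = eq

      vertices⊆ends : vertices i ⊆ map end (edgesOf k)
      vertices⊆ends {v} v∈ with every-colour-at v k
      ... | inj₁ vk             = contradiction (trans (sym (∈-vertices⁻ v∈)) vk) i≢k
      ... | inj₂ (e , v∈e , ek) = subst (_∈ _) (sym (incident⇒end e (∈-vertices⁻ v∈) v∈e))
                                    (∈-map⁺ end (∈-edgesOf⁺ ek))

    order≤sum : ∀ {i j k l} → (∀ x → x ∈ i ∷ j ∷ k ∷ l ∷ []) →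
                n ≤ length (vertices i) + (length (vertices j) + (length (vertices k) + length (vertices l)))
    order≤sum {i} {j} {k} {l} all = ≤-trans (length-covering cover) (≤-reflexive
      (trans (length-++ (vertices i)) (cong (_ +_)
        (trans (length-++ (vertices j)) (cong (_ +_) (length-++ (vertices k)))))))
      where
      cover : ∀ v → v ∈ vertices i ++ (vertices j ++ (vertices k ++ vertices l))
      cover v with all (vertexColour v)
      ... | here eq                         = ∈-++⁺ˡ (∈-vertices⁺ eq)
      ... | there (here eq)                 = ∈-++⁺ʳ (vertices i) (∈-++⁺ˡ (∈-vertices⁺ eq))
      ... | there (there (here eq))         =
        ∈-++⁺ʳ (vertices i) (∈-++⁺ʳ (vertices j) (∈-++⁺ˡ (∈-vertices⁺ eq)))
      ... | there (there (there (here eq))) =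
        ∈-++⁺ʳ (vertices i) (∈-++⁺ʳ (vertices j) (∈-++⁺ʳ (vertices k) (∈-vertices⁺ eq)))

    -- Equitability below order 12.

    class-≤ : n < 12 → ∀ {i j} → i ≢ j → length (class i) ≤ suc (length (class j))
    class-≤ n<12 {i} {j} i≢j rewrite length-class i | length-class j with two-others i j i≢j
    -- A failure of the bound is `suc (length (class j)) < length (class i)`, which unfolds to the
    -- gap of 2 required by `unbalanced⇒12≤n`.
    ... | k , l , i≢k , i≢l , all = ≮⇒≥ (λ gap → <⇒≱ n<12
      (unbalanced⇒12≤n (length (vertices i)) (length (vertices j)) (length (vertices k)) (length (vertices l))
        (perfect i) (perfect j) (perfect k) (perfect l)
        (vertices≤edges i≢k) (vertices≤edges i≢l) (order≤sum all) gap))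

    equitable : n < 12 → Equitable c
    equitable n<12 i j with i ≟ j
    ... | yes refl = ≤-trans (≤-reflexive (∣n-n∣≡0 (length (class i)))) z≤n
    ... | no  i≢j  = ∣m-n∣≤1 (class-≤ n<12 i≢j) (class-≤ n<12 (i≢j ∘ sym))

-- A non-equitable colouring of the circular ladder.

L₁₂-cubic : Cubic L₁₂
L₁₂-cubic = toWitness {a? = all? λ v → Graph.degree L₁₂ v ℕ.≟ 3} _

module Colouring where
  open Graph L₁₂ using (_~_; _~?_)
  open Edge using (lo; hi)

  -- Consistent around the 6-cycles because 3 divides 6: a step along a cycle or a rung changes the
  -- value by 1 modulo 3.
  vertexColour₃ : Fin 12 → Fin 3
  vertexColour₃ v with a , b ← remQuot {6} 2 v = (toℕ a + toℕ b) mod 3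

  rung? : (e : Edge L₁₂) → Dec (proj₁ (remQuot {6} 2 (lo e)) ≡ proj₁ (remQuot {6} 2 (hi e)))
  rung? e = _ ≟ _

  L₁₂-colour : Element L₁₂ → Colour
  L₁₂-colour (inj₁ v) = inject₁ (vertexColour₃ v)
  L₁₂-colour (inj₂ e) with rung? e
  ... | yes _ = # 3
  -- The elements of ℤ/3 sum to 0, so −(x + y) = 2(x + y) is the third one.
  ... | no  _ = inject₁ ((2 * (toℕ (vertexColour₃ (lo e)) + toℕ (vertexColour₃ (hi e)))) mod 3)

  incident? : ∀ v (e : Edge L₁₂) → Dec (Incident v e)
  incident? v e = (v ≟ lo e) ⊎-dec (v ≟ hi e)

  -- The proof fields are irrelevant, so comparing endpoints suffices.
  _≟ᵉ_ : (e f : Edge L₁₂) → Dec (e ≡ f)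
  edge u v _ _ ≟ᵉ edge u′ v′ _ _ with u ≟ u′ | v ≟ v′
  ... | yes refl | yes refl = yes refl
  ... | no u≢u′  | _        = no λ { refl → u≢u′ refl }
  ... | _        | no v≢v′  = no λ { refl → v≢v′ refl }

  L₁₂-colouring : TotalColouring L₁₂
  L₁₂-colouring = record
    { colour          = L₁₂-colour
    ; vertex-proper   = λ {u} {v} → toWitness {a? = all? λ u → all? λ v →
        (u ~? v) →-dec ¬? (L₁₂-colour (inj₁ u) ≟ L₁₂-colour (inj₁ v))} _ u v
    -- Exhaustive check over the finite list `edges L₁₂`, carried to arbitrary edges by `∈-edges`.
    ; edge-proper     = λ {v} {e} {f} e≢f v∈e v∈f → All.lookup (All.lookup
        (toWitness {a? = All.all? (λ e → All.all? (λ f →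
          ¬? (e ≟ᵉ f) →-dec (all? λ v → incident? v e →-dec (incident? v f →-dec
            ¬? (L₁₂-colour (inj₂ e) ≟ L₁₂-colour (inj₂ f))))) (edges L₁₂)) (edges L₁₂)} _)
        (∈-edges L₁₂ e)) (∈-edges L₁₂ f) e≢f v v∈e v∈f
    ; incident-proper = λ {v} {e} → All.lookup (toWitness {a? = All.all? (λ e → all? λ v →
        incident? v e →-dec ¬? (L₁₂-colour (inj₁ v) ≟ L₁₂-colour (inj₂ e))) (edges L₁₂)} _)
        (∈-edges L₁₂ e) v
    }

  L₁₂-nonEquitable : NonEquitable L₁₂-colouring
  -- Colour 0 has 4 vertices and 4 edges, colour 3 only the 6 rungs, so equitability would give
  -- `2 ≤ 1`.
  L₁₂-nonEquitable equitable with s≤s () ← equitable (# 0) (# 3)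

open Colouring using (L₁₂-colouring; L₁₂-nonEquitable)

corollary5p1 : ¬ (∀ {n : ℕ} (G : Graph n) → Cubic G → order G < 20 → (c : TotalColouring G) → Equitable c)
    × (Cubic L₁₂ × order L₁₂ ≡ 12 × ∃[ c ] NonEquitable {G = L₁₂} c)
    × (∀ {n : ℕ} (G : Graph n) → Cubic G → order G < 12 → (c : TotalColouring G) → Equitable c)
corollary5p1 =
    -- `12 < 20` unfolds to `13 ≤ 13 + 7`.
    (λ all-equitable → L₁₂-nonEquitable (all-equitable L₁₂ L₁₂-cubic (m≤m+n 13 7) L₁₂-colouring))
  , (L₁₂-cubic , refl , L₁₂-colouring , L₁₂-nonEquitable)
  , λ _ cubic n<12 c → equitable cubic c n<12
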